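{- For any set $\varPhi\cup\{\varphi\}\subseteq Fm_\equiv$: $\ \varPhi\Vdash_{\mathit{SCI}}\varphi\ \Leftrightarrow\ \varPhi\vdash_{\mathit{SCI}}\varphi$.
   Context: Language: $Fm_\equiv$ is the set of formulas built from an infinite set $V=\{x_0,x_1,\dots\}$ of propositional variables, $\bot,\top$, and connectives $\neg,\vee,\wedge,\rightarrow,\equiv$. Logic $\mathit{SCI}$: axioms are all formulas having the form of a classical tautology (substitution instances of classical propositional tautologies) and all formulas of the forms $\varphi\equiv\varphi$; $(\varphi\equiv\psi)\rightarrow(\varphi\rightarrow\psi)$; $(\varphi\equiv\psi)\rightarrow(\neg\varphi\equiv\neg\psi)$; $((\varphi_1\equiv\psi_1)\wedge(\varphi_2\equiv\psi_2))\rightarrow((\varphi_1*\varphi_2)\equiv(\psi_1*\psi_2))$ for $*\in\{\vee,\wedge,\rightarrow,\equiv\}$. The only rule is Modus Ponens. $\varPhi\vdash_{\mathit{SCI}}\varphi$ means there is a derivation of $\varphi$ from $\varPhi$. Boolean prealgebras: A Boolean algebra is regarded as a structure $(B,f_\vee,f_\wedge,f_\neg,f_\bot,f_\top,f_\rightarrow)$ with $f_\rightarrow(a,b)=f_\vee(f_\neg(a),b)$. A structure $\mathcal{B}=(B,f_\vee,f_\wedge,f_\neg,f_\bot,f_\top,f_\rightarrow,\preceq)$ with operations of arities $(2,2,1,0,0,2)$ and a preorder $\preceq$ is a Boolean prealgebra if $a\approx b:\Leftrightarrow(a\preceq b$ and $b\preceq a)$ is a congruence relation, $\mathcal{B}/{\approx}$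 is a Boolean algebra, and for all $a,b$: $a\preceq b\Leftrightarrow f_\wedge(a,b)\approx a$. A subset $F\subseteq B$ closed under $\approx$ is an ultrafilter of $\mathcal{B}$ if $\{\overline{a}\mid a\in F\}$ is an ultrafilter of $\mathcal{B}/{\approx}$. An $\mathit{SCI}$-model is a structure $\mathcal{M}=(M,\mathit{TRUE},f_\vee,f_\wedge,f_\neg,f_\bot,f_\top,f_\rightarrow,f_\equiv,\preceq)$ where $(M,f_\vee,f_\wedge,f_\neg,f_\bot,f_\top,f_\rightarrow,\preceq)$ is a Boolean prealgebra, $\mathit{TRUE}\subseteq M$ is an ultrafilter of it, and $f_\equiv$ is a binary function with $f_\equiv(m,m')\in\mathit{TRUE}\Leftrightarrow m=m'$. An assignment $\gamma\colon V\to M$ extends to $Fm_\equiv$ by $\gamma(\bot)=f_\bot$, $\gamma(\top)=f_\top$, $\gamma(\neg\varphi)=f_\neg(\gamma(\varphi))$, $\gamma(\varphi*\psi)=f_*(\gamma(\varphi),\gamma(\psi))$ for $*\in\{\vee,\wedge,\rightarrow,\equiv\}$. Satisfaction: $(\mathcal{M},\gamma)\vDash\varphi:\Leftrightarrow\gamma(\varphi)\in\mathit{TRUE}$. $\varPhi\Vdash_{\mathit{SCI}}\varphi$ means: every pair $(\mathcal{M},\gamma)$ of an $\mathit{SCI}$-model and an assignment that satisfies all formulas of $\varPhi$ satisfies $\varphi$. -}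

module Defs where

open import Level using (Level; suc; _⊔_)
open import Data.Bool as Bool using (Bool; true; false)
open import Data.Nat using (ℕ)
open import Data.Product using (_×_)
open import Algebra.Core using (Op₁; Op₂)
open import Algebra.Definitions using (Congruent₂)
open import Algebra.Lattice.Bundles using (BooleanAlgebra)
open import Algebra.Lattice.Structures using (IsBooleanAlgebra)
open import Function.Bundles using (_⇔_)
open import Relation.Binary.Core using (Rel)
open import Relation.Binary.Definitions using (_Respects_)
open import Relation.Binary.PropositionalEquality using (_≡_)
open import Relation.Binary.Structures using (IsPreorder)
open import Relation.Unary using (Pred; _∈_; _∉_; _⊆_)

private
  variable
    ℓ c ℓ≈ p : Level

infix  9 ~_
infixr 7 _⋀_
infixr 6 _⋁_
infixr 5 _⊃_
infix  8 _≣_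

data Fm : Set where
  var             : ℕ → Fm
  bot top         : Fm
  ~_              : Fm → Fm
  _⋁_ _⋀_ _⊃_ _≣_ : Fm → Fm → Fm

-- Classical propositional formulas (without the identity connective); their
-- substitution instances in Fm are the formulas "having the form of a
-- classical tautology".

data PFm : Set where
  pvar           : ℕ → PFm
  pbot ptop      : PFm
  pneg           : PFm → PFm
  por pand pimp  : PFm → PFm → PFm

truth : (ℕ → Bool) → PFm → Bool
truth v (pvar n)   = v n
truth v pbot       = false
truth v ptop       = true
truth v (pneg α)   = Bool.not (truth v α)
truth v (por α β)  = truth v α Bool.∨ truth v β
truth v (pand α β) = truth v α Bool.∧ truth v β
truth v (pimp α β) = Bool.not (truth v α) Bool.∨ truth v β

Tautology : PFm → Set
Tautology α = ∀ v → truth v α ≡ true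

_[_] : PFm → (ℕ → Fm) → Fm
pvar n   [ σ ] = σ n
pbot     [ σ ] = bot
ptop     [ σ ] = top
pneg α   [ σ ] = ~ (α [ σ ])
por α β  [ σ ] = (α [ σ ]) ⋁ (β [ σ ])
pand α β [ σ ] = (α [ σ ]) ⋀ (β [ σ ])
pimp α β [ σ ] = (α [ σ ]) ⊃ (β [ σ ])

data Axiom : Fm → Set where
  taut   : ∀ α → Tautology α → ∀ σ → Axiom (α [ σ ])
  ≣-refl : ∀ φ → Axiom (φ ≣ φ)
  ≣-⊃    : ∀ φ ψ → Axiom ((φ ≣ ψ) ⊃ (φ ⊃ ψ))
  cong-~ : ∀ φ ψ → Axiom ((φ ≣ ψ) ⊃ ((~ φ) ≣ (~ ψ)))
  cong-⋁ : ∀ φ₁ ψ₁ φ₂ ψ₂ →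
           Axiom (((φ₁ ≣ ψ₁) ⋀ (φ₂ ≣ ψ₂)) ⊃ ((φ₁ ⋁ φ₂) ≣ (ψ₁ ⋁ ψ₂)))
  cong-⋀ : ∀ φ₁ ψ₁ φ₂ ψ₂ →
           Axiom (((φ₁ ≣ ψ₁) ⋀ (φ₂ ≣ ψ₂)) ⊃ ((φ₁ ⋀ φ₂) ≣ (ψ₁ ⋀ ψ₂)))
  cong-⊃ : ∀ φ₁ ψ₁ φ₂ ψ₂ →
           Axiom (((φ₁ ≣ ψ₁) ⋀ (φ₂ ≣ ψ₂)) ⊃ ((φ₁ ⊃ φ₂) ≣ (ψ₁ ⊃ ψ₂)))
  cong-≣ : ∀ φ₁ ψ₁ φ₂ ψ₂ →
           Axiom (((φ₁ ≣ ψ₁) ⋀ (φ₂ ≣ ψ₂)) ⊃ ((φ₁ ≣ φ₂) ≣ (ψ₁ ≣ ψ₂)))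

infix 3 _⊢_

data _⊢_ (Φ : Pred Fm ℓ) : Fm → Set ℓ where
  hyp   : ∀ {φ} → φ ∈ Φ → Φ ⊢ φ
  axiom : ∀ {φ} → Axiom φ → Φ ⊢ φ
  mp    : ∀ {φ ψ} → Φ ⊢ φ → Φ ⊢ φ ⊃ ψ → Φ ⊢ ψ

-- The carrier of a BooleanAlgebra is a setoid, so its subsets are the
-- predicates that respect _≈_; a ∧ b ≈ a expresses a ≤ b.

record IsProperFilter (B : BooleanAlgebra c ℓ≈)
                      (F : Pred (BooleanAlgebra.Carrier B) p) :
                      Set (c ⊔ ℓ≈ ⊔ p) where
  open BooleanAlgebra B
  field
    respects : F Respects _≈_
    ⊤∈       : ⊤ ∈ F
    ∧-closed : ∀ {a b} → a ∈ F → b ∈ F → (a ∧ b) ∈ F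
    upward   : ∀ {a b} → a ∈ F → (a ∧ b) ≈ a → b ∈ F
    ⊥∉       : ⊥ ∉ F

record IsUltrafilter (B : BooleanAlgebra c ℓ≈)
                     (F : Pred (BooleanAlgebra.Carrier B) p) :
                     Set (c ⊔ ℓ≈ ⊔ suc p) where
  field
    isProperFilter : IsProperFilter B F
    maximal        : ∀ (G : Pred (BooleanAlgebra.Carrier B) p) →
                     IsProperFilter B G → F ⊆ G → G ⊆ F

record BooleanPrealgebra ℓ : Set (suc ℓ) where
  infix 4 _⪯_ _≈_
  field
    Carrier  : Set ℓ
    f∨ f∧ f→ : Op₂ Carrier
    f¬       : Op₁ Carrier
    f⊥ f⊤    : Carrier
    _⪯_      : Rel Carrier ℓ

  _≈_ : Rel Carrier ℓ
  a ≈ b = a ⪯ b × b ⪯ a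

  field
    isPreorder : IsPreorder _≡_ _⪯_
    -- The quotient by _≈_ is the same carrier with _≈_ as its equality. That
    -- _≈_ is a congruence for f∨, f∧ and f¬ is part of IsBooleanAlgebra.
    quotientIsBooleanAlgebra : IsBooleanAlgebra _≈_ f∨ f∧ f¬ f⊤ f⊥
    f→-cong    : Congruent₂ _≈_ f→
    f→-def     : ∀ a b → f→ a b ≈ f∨ (f¬ a) b
    ⪯⇔∧        : ∀ a b → a ⪯ b ⇔ f∧ a b ≈ a

  quotient : BooleanAlgebra ℓ ℓ
  quotient = record { isBooleanAlgebra = quotientIsBooleanAlgebra }

record SCIModel ℓ : Set (suc ℓ) where
  field
    booleanPrealgebra : BooleanPrealgebra ℓ

  open BooleanPrealgebra booleanPrealgebra public

  field
    TRUE          : Pred Carrier ℓ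
    isUltrafilter : IsUltrafilter quotient TRUE
    f≡            : Op₂ Carrier
    f≡-identity   : ∀ m m′ → f≡ m m′ ∈ TRUE ⇔ m ≡ m′

module _ (M : SCIModel ℓ) where
  open SCIModel M

  ⟦_⟧ : Fm → (ℕ → Carrier) → Carrier
  ⟦ var n ⟧ γ = γ n
  ⟦ bot   ⟧ γ = f⊥
  ⟦ top   ⟧ γ = f⊤
  ⟦ ~ φ   ⟧ γ = f¬ (⟦ φ ⟧ γ)
  ⟦ φ ⋁ ψ ⟧ γ = f∨ (⟦ φ ⟧ γ) (⟦ ψ ⟧ γ)
  ⟦ φ ⋀ ψ ⟧ γ = f∧ (⟦ φ ⟧ γ) (⟦ ψ ⟧ γ)
  ⟦ φ ⊃ ψ ⟧ γ = f→ (⟦ φ ⟧ γ) (⟦ ψ ⟧ γ)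
  ⟦ φ ≣ ψ ⟧ γ = f≡ (⟦ φ ⟧ γ) (⟦ ψ ⟧ γ)

  Satisfies : (ℕ → Carrier) → Fm → Set ℓ
  Satisfies γ φ = ⟦ φ ⟧ γ ∈ TRUE

infix 3 _⊩_

-- The level ℓ plays the role of the universe of sets: both the set of premises
-- and the models live in it.
_⊩_ : Pred Fm ℓ → Fm → Set (suc ℓ)
_⊩_ {ℓ} Φ φ = ∀ (M : SCIModel ℓ) (γ : ℕ → SCIModel.Carrier M) →
              (∀ ψ → ψ ∈ Φ → Satisfies M γ ψ) → Satisfies M γ φ

{-# OPTIONS --safe #-}
module Submission where

-- Soundness: by maximality, the ultrafilter TRUE of a model decides every
-- element, so membership in TRUE is a Boolean valuation and satisfies all
-- tautologies.
--
-- Completeness: if φ is not derivable from Φ, extend Φ to a theory T maximal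
-- among those not deriving φ. The carrier of the countermodel is Fm modulo
-- T ⊢ ψ ≣ χ; as f≡ must detect propositional equality, the quotient is realised
-- by the least codes of formulas. The preorder compares only the truth values
-- under T, so the associated Boolean algebra has two elements; the prealgebra
-- may be this coarse because f≡ is not tied to ⪯.

open import Defs
open import Level using (Level; Lift; lift)
open import Algebra.Core using (Op₁; Op₂)
open import Algebra.Lattice.Bundles using (BooleanAlgebra)
import Algebra.Lattice.Morphism.LatticeMonomorphism as LatticeMonomorphism
open import Algebra.Lattice.Structures using (IsBooleanAlgebra)
import Algebra.Lattice.Properties.BooleanAlgebra as BooleanAlgebraProperties
open import Axiom.ExcludedMiddle using (ExcludedMiddle)
open import Data.Bool as Bool using (Bool; true; false)
import Data.Bool.Properties as Bool
open import Data.List using (List; []; _∷_; _++_; foldl; length)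
open import Data.List.Properties using (foldl-++)
open import Data.Nat using (ℕ; zero; suc; _+_; _⊔_; _≤_; _<_; _≤′_; ≤′-refl; ≤′-step)
open import Data.Nat.Induction using (<-rec)
open import Data.Nat.Properties
  using (+-suc; +-identityʳ; ≮⇒≥; ≤-antisym; ≡-irrelevant; ≤⇒≤′; m≤m⊔n; m≤n⊔m)
open import Data.Product using (_×_; _,_; ∃; proj₁; proj₂; uncurry)
open import Data.Sum using (_⊎_; inj₁; inj₂; [_,_]; map₂)
open import Function using (_∘_; id)
open import Function.Bundles using (_⇔_; mk⇔; Equivalence)
open import Relation.Binary.Core using (Rel)
open import Relation.Binary.PropositionalEquality
  using (_≡_; refl; sym; trans; cong; cong₂; subst; module ≡-Reasoning)
open import Relation.Binary.Structures using (IsEquivalence)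
open import Relation.Nullary
  using (¬_; does; yes; no; contradiction; Reflects; ofʸ; ofⁿ; proof)
open import Relation.Nullary.Decidable using (dec-true; dec-false)
open import Relation.Nullary.Reflects using (¬-reflects; _×-reflects_; _⊎-reflects_)
open import Relation.Unary using (Pred; _∈_; _∉_; _⊆_; _∪_; ｛_｝)

private
  variable
    ℓ a : Level
    Φ Ψ : Pred Fm ℓ
    φ ψ χ : Fm

-- Derivations

⊢-mono : Φ ⊆ Ψ → Φ ⊢ φ → Ψ ⊢ φ
⊢-mono Φ⊆Ψ (hyp φ∈Φ) = hyp (Φ⊆Ψ φ∈Φ)
⊢-mono Φ⊆Ψ (axiom ax) = axiom ax
⊢-mono Φ⊆Ψ (mp d e)   = mp (⊢-mono Φ⊆Ψ d) (⊢-mono Φ⊆Ψ e)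

pimp-intro : ∀ v α β → (truth v α ≡ true → truth v β ≡ true) →
             truth v (pimp α β) ≡ true
pimp-intro v α β f with truth v α
... | true  = f refl
... | false = refl

pimp-elim : ∀ v α β → truth v (pimp α β) ≡ true →
            truth v α ≡ true → truth v β ≡ true
pimp-elim v α β αβ α-true with truth v α
pimp-elim v α β αβ refl | true = αβ

-- Every instance of a tautology is an axiom, so an entailment checked on truth values becomes a
-- derivation by `mp`. All propositional reasoning below is done this way instead of by
-- Hilbert-style derivations.
consequence₁ : ∀ α β → (∀ v → truth v α ≡ true → truth v β ≡ true) →
               ∀ σ → Φ ⊢ α [ σ ] → Φ ⊢ β [ σ ]
consequence₁ α β f σ d =
  mp d (axiom (taut (pimp α β) (λ v → pimp-intro v α β (f v)) σ))

consequence₂ : ∀ α β γ →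
               (∀ v → truth v α ≡ true → truth v β ≡ true → truth v γ ≡ true) →
               ∀ σ → Φ ⊢ α [ σ ] → Φ ⊢ β [ σ ] → Φ ⊢ γ [ σ ]
consequence₂ α β γ f σ d e =
  mp e (consequence₁ α (pimp β γ) (λ v t → pimp-intro v β γ (f v t)) σ d)

⟨_,_,_⟩ : Fm → Fm → Fm → ℕ → Fm
⟨ φ , ψ , χ ⟩ 0 = φ
⟨ φ , ψ , χ ⟩ 1 = ψ
⟨ φ , ψ , χ ⟩ _ = χ

private
  p q r : PFm
  p = pvar 0
  q = pvar 1
  r = pvar 2

⊢-weaken : Φ ⊢ φ → Φ ⊢ ψ ⊃ φ
⊢-weaken {φ = φ} {ψ} =
  consequence₁ p (pimp q p) (λ v t → pimp-intro v q p λ _ → t) ⟨ φ , ψ , φ ⟩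

⊢-distrib : Φ ⊢ φ ⊃ ψ → Φ ⊢ φ ⊃ (ψ ⊃ χ) → Φ ⊢ φ ⊃ χ
⊢-distrib {φ = φ} {ψ} {χ} =
  consequence₂ (pimp p q) (pimp p (pimp q r)) (pimp p r)
    (λ v s t → pimp-intro v p r λ x →
      pimp-elim v q r (pimp-elim v p (pimp q r) t x) (pimp-elim v p q s x))
    ⟨ φ , ψ , χ ⟩

⊢-⊃-refl : Φ ⊢ φ ⊃ φ
⊢-⊃-refl {φ = φ} =
  axiom (taut (pimp p p) (λ v → pimp-intro v p p id) ⟨ φ , φ , φ ⟩)

⊢-⋀-intro : Φ ⊢ φ → Φ ⊢ ψ → Φ ⊢ φ ⋀ ψ
⊢-⋀-intro {φ = φ} {ψ} =
  consequence₂ p q (pand p q) (λ v → cong₂ Bool._∧_) ⟨ φ , ψ , φ ⟩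

⊢-cases : Φ ⊢ φ ⊃ ψ → Φ ⊢ (~ φ) ⊃ ψ → Φ ⊢ ψ
⊢-cases {φ = φ} {ψ} = consequence₂ (pimp p q) (pimp (pneg p) q) q by-cases ⟨ φ , ψ , φ ⟩
  where
  by-cases : ∀ v → truth v (pimp p q) ≡ true → truth v (pimp (pneg p) q) ≡ true →
             v 1 ≡ true
  by-cases v s t with v 0
  ... | true  = s
  ... | false = t

⊢-explosion : Φ ⊢ bot → Φ ⊢ φ
⊢-explosion {φ = φ} = consequence₁ pbot p (λ v ()) ⟨ φ , φ , φ ⟩

⊢-contradiction : Φ ⊢ φ → Φ ⊢ ~ φ → Φ ⊢ bot
⊢-contradiction {φ = φ} = consequence₂ p (pneg p) pbot absurd ⟨ φ , φ , φ ⟩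
  where
  absurd : ∀ v → v 0 ≡ true → Bool.not (v 0) ≡ true → false ≡ true
  absurd v s t = trans (cong Bool.not (sym s)) t

deduction : Φ ∪ ｛ ψ ｝ ⊢ φ → Φ ⊢ ψ ⊃ φ
deduction (hyp (inj₁ φ∈Φ)) = ⊢-weaken (hyp φ∈Φ)
deduction (hyp (inj₂ refl)) = ⊢-⊃-refl
deduction (axiom ax)        = ⊢-weaken (axiom ax)
deduction (mp d e)          = ⊢-distrib (deduction d) (deduction e)

⊢-≣-elim : Φ ⊢ φ ≣ ψ → Φ ⊢ φ → Φ ⊢ ψ
⊢-≣-elim d e = mp e (mp d (axiom (≣-⊃ _ _)))

⊢-≣-cong-≣ : ∀ {φ₁ ψ₁ φ₂ ψ₂} → Φ ⊢ φ₁ ≣ ψ₁ → Φ ⊢ φ₂ ≣ ψ₂ → Φ ⊢ (φ₁ ≣ φ₂) ≣ (ψ₁ ≣ ψ₂)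
⊢-≣-cong-≣ d e = mp (⊢-⋀-intro d e) (axiom (cong-≣ _ _ _ _))

-- Symmetry and transitivity come from congruence of `≣` with respect to itself: from `φ ≣ ψ` one
-- gets `(φ ≣ φ) ≣ (ψ ≣ φ)`, and from `ψ ≣ χ` one gets `(φ ≣ ψ) ≣ (φ ≣ χ)`. In both cases the left
-- side is already derivable.
⊢-≣-isEquivalence : IsEquivalence (λ φ ψ → Φ ⊢ φ ≣ ψ)
⊢-≣-isEquivalence {Φ = Φ} = record
  { refl  = ≣-refl′
  ; sym   = λ d → ⊢-≣-elim (⊢-≣-cong-≣ d ≣-refl′) ≣-refl′
  ; trans = λ d e → ⊢-≣-elim (⊢-≣-cong-≣ ≣-refl′ e) d
  }
  where
  ≣-refl′ : Φ ⊢ φ ≣ φ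
  ≣-refl′ = axiom (≣-refl _)

-- Enumeration of the formulas

-- One step of Cantor's walk through the antidiagonals of `ℕ × ℕ`.
next : ℕ × ℕ → ℕ × ℕ
next (x , zero)  = zero , suc x
next (x , suc y) = suc x , y

unpair : ℕ → ℕ × ℕ
unpair zero    = zero , zero
unpair (suc n) = next (unpair n)

unpair-surjective : ∀ x y → ∃ λ n → unpair n ≡ (x , y)
unpair-surjective x y = onDiagonal (x + y) x y refl
  where
  -- The recursion runs the walk backwards: it decreases `x` along one diagonal and, at `x = 0`,
  -- passes to the end of the previous diagonal.
  onDiagonal : ∀ s x y → x + y ≡ s → ∃ λ n → unpair n ≡ (x , y)
  onDiagonal s zero zero _ = zero , refl
  onDiagonal (suc s) zero (suc y) refl =
    let n , eq = onDiagonal s y zero (+-identityʳ y) in suc n , cong next eq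
  onDiagonal s (suc x) y eq =
    let n , eq′ = onDiagonal s x (suc y) (trans (+-suc x y) eq) in suc n , cong next eq′

decodeList : ℕ → ℕ → List ℕ
decodeList zero    n = []
decodeList (suc l) n = proj₁ (unpair n) ∷ decodeList l (proj₂ (unpair n))

decodeList-surjective : ∀ xs → ∃ λ n → decodeList (length xs) n ≡ xs
decodeList-surjective []       = zero , refl
decodeList-surjective (x ∷ xs) =
  let m , eq  = decodeList-surjective xs
      n , eq′ = unpair-surjective x m
  in n , cong₂ _∷_ (cong proj₁ eq′)
                   (trans (cong (decodeList (length xs) ∘ proj₂) eq′) eq)

-- A list of numbers is read as a program in reverse Polish notation acting on a
-- stack of formulas.
push : ℕ → List Fm → List Fm
push 0 s           = bot ∷ s
push 1 s           = top ∷ s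
push 2 (φ ∷ s)     = (~ φ) ∷ s
push 3 (ψ ∷ φ ∷ s) = (φ ⋁ ψ) ∷ s
push 4 (ψ ∷ φ ∷ s) = (φ ⋀ ψ) ∷ s
push 5 (ψ ∷ φ ∷ s) = (φ ⊃ ψ) ∷ s
push 6 (ψ ∷ φ ∷ s) = (φ ≣ ψ) ∷ s
push (suc (suc (suc (suc (suc (suc (suc n))))))) s = var n ∷ s
push _ s           = s

run : List Fm → List ℕ → List Fm
run = foldl λ s n → push n s

program : Fm → List ℕ
program (var n) = 7 + n ∷ []
program bot     = 0 ∷ []
program top     = 1 ∷ []
program (~ φ)   = program φ ++ 2 ∷ []
program (φ ⋁ ψ) = program φ ++ program ψ ++ 3 ∷ []
program (φ ⋀ ψ) = program φ ++ program ψ ++ 4 ∷ []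
program (φ ⊃ ψ) = program φ ++ program ψ ++ 5 ∷ []
program (φ ≣ ψ) = program φ ++ program ψ ++ 6 ∷ []

-- The stack `s` and the remaining program `ns` are arbitrary so that the induction hypothesis
-- applies to operands in the middle of a program.
run-program : ∀ φ s ns → run s (program φ ++ ns) ≡ run (φ ∷ s) ns

run-program₂ : ∀ φ ψ n s ns →
  run s ((program φ ++ program ψ ++ n ∷ []) ++ ns) ≡
  run (push n (ψ ∷ φ ∷ s)) ns
run-program₂ φ ψ n s ns = begin
  run s ((program φ ++ program ψ ++ n ∷ []) ++ ns)
    ≡⟨ foldl-++ _ s (program φ ++ program ψ ++ n ∷ []) ns ⟩
  run (run s (program φ ++ program ψ ++ n ∷ [])) ns
    ≡⟨ cong (λ s → run s ns) (run-program φ s (program ψ ++ n ∷ [])) ⟩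
  run (run (φ ∷ s) (program ψ ++ n ∷ [])) ns
    ≡⟨ cong (λ s → run s ns) (run-program ψ (φ ∷ s) (n ∷ [])) ⟩
  run (push n (ψ ∷ φ ∷ s)) ns ∎
  where open ≡-Reasoning

run-program (var n) s ns = refl
run-program bot     s ns = refl
run-program top     s ns = refl
run-program (~ φ)   s ns = begin
  run s ((program φ ++ 2 ∷ []) ++ ns)
    ≡⟨ foldl-++ _ s (program φ ++ 2 ∷ []) ns ⟩
  run (run s (program φ ++ 2 ∷ [])) ns
    ≡⟨ cong (λ s → run s ns) (run-program φ s (2 ∷ [])) ⟩
  run ((~ φ) ∷ s) ns ∎
  where open ≡-Reasoning
run-program (φ ⋁ ψ) s ns = run-program₂ φ ψ 3 s ns
run-program (φ ⋀ ψ) s ns = run-program₂ φ ψ 4 s ns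
run-program (φ ⊃ ψ) s ns = run-program₂ φ ψ 5 s ns
run-program (φ ≣ ψ) s ns = run-program₂ φ ψ 6 s ns

topOfStack : List Fm → Fm
topOfStack []      = bot
topOfStack (φ ∷ _) = φ

abstract
  -- A code pairs the length of a program with the code of its entries. Only surjectivity matters
  -- later, so ill-formed programs may denote any formula and repetitions do no harm.
  formula : ℕ → Fm
  formula n = topOfStack (run [] (uncurry decodeList (unpair n)))

  formula-surjective : ∀ φ → ∃ λ n → formula n ≡ φ
  formula-surjective φ =
    let m , eq  = decodeList-surjective (program φ ++ [])
        n , eq′ = unpair-surjective (length (program φ ++ [])) m
    in n , trans (cong (topOfStack ∘ run []) (trans (cong (uncurry decodeList) eq′) eq))
                 (cong topOfStack (run-program φ [] []))

-- Quotients of countable types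

least : ExcludedMiddle ℓ → (P : Pred ℕ ℓ) → ∃ P →
        ∃ λ n → P n × (∀ {m} → P m → n ≤ m)
least em P (n , Pn) = <-rec (λ n → P n → ∃ λ n → P n × (∀ {m} → P m → n ≤ m)) descend n Pn
  where
  descend : ∀ n → (∀ {k} → k < n → P k → ∃ λ n → P n × (∀ {m} → P m → n ≤ m)) →
            P n → ∃ λ n → P n × (∀ {m} → P m → n ≤ m)
  descend n rec Pn with em {∃ λ m → m < n × P m}
  ... | yes (m , m<n , Pm) = rec m<n Pm
  ... | no none            = n , Pn , λ Pm → ≮⇒≥ λ m<n → none (_ , m<n , Pm)

module Quotient {A : Set a} (em : ExcludedMiddle ℓ)
                (enum : ℕ → A) (enum-surjective : ∀ x → ∃ λ n → enum n ≡ x)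
                {_~_ : Rel A ℓ} (isEquivalence : IsEquivalence _~_) where

  open IsEquivalence isEquivalence
    renaming (refl to ~-refl; sym to ~-sym; trans to ~-trans)

  abstract
    leastCode : ∀ x → ∃ λ n → enum n ~ x × (∀ {m} → enum m ~ x → n ≤ m)
    leastCode x = least em (λ n → enum n ~ x)
      (let n , eq = enum-surjective x in n , subst (_~ x) (sym eq) ~-refl)

  index : A → ℕ
  index = proj₁ ∘ leastCode

  index-sound : ∀ x → enum (index x) ~ x
  index-sound = proj₁ ∘ proj₂ ∘ leastCode

  index-≤ : ∀ {x y} → x ~ y → index x ≤ index y
  index-≤ {x} {y} x~y =
    proj₂ (proj₂ (leastCode x)) (~-trans (index-sound y) (~-sym x~y))

  index-cong : ∀ {x y} → x ~ y → index x ≡ index y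
  index-cong x~y = ≤-antisym (index-≤ x~y) (index-≤ (~-sym x~y))

  -- At the level of _~_ rather than 0, where models have their carriers.
  data Class : Set ℓ where
    class : ∀ n → index (enum n) ≡ n → Class

  code : Class → ℕ
  code (class n _) = n

  canonical : ∀ c → index (enum (code c)) ≡ code c
  canonical (class _ eq) = eq

  -- Equality proofs in `ℕ` are unique, so the proof stored in a class cannot distinguish two
  -- classes with the same code.
  class-≡ : {c d : Class} → code c ≡ code d → c ≡ d
  class-≡ {class n _} {class _ _} refl = cong (class n) (≡-irrelevant _ _)

  repr : Class → A
  repr = enum ∘ code

  classOf : A → Class
  classOf x = class (index x) (index-cong (index-sound x))

  repr-classOf : ∀ x → repr (classOf x) ~ x
  repr-classOf = index-sound

  classOf-cong : ∀ {x y} → x ~ y → classOf x ≡ classOf y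
  classOf-cong = class-≡ ∘ index-cong

  repr-injective : ∀ {c d} → repr c ~ repr d → c ≡ d
  repr-injective {c} {d} c~d =
    class-≡ (trans (sym (canonical c)) (trans (index-cong c~d) (canonical d)))

-- Models with two truth values

module TwoValued
  {Carrier : Set ℓ} (f∨ f∧ f→ f≡ : Op₂ Carrier) (f¬ : Op₁ Carrier) (f⊥ f⊤ : Carrier)
  (value : Carrier → Bool)
  (value-∨ : ∀ x y → value (f∨ x y) ≡ value x Bool.∨ value y)
  (value-∧ : ∀ x y → value (f∧ x y) ≡ value x Bool.∧ value y)
  (value-→ : ∀ x y → value (f→ x y) ≡ Bool.not (value x) Bool.∨ value y)
  (value-¬ : ∀ x → value (f¬ x) ≡ Bool.not (value x))
  (value-⊥ : value f⊥ ≡ false)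
  (value-⊤ : value f⊤ ≡ true)
  (value-≡ : ∀ x y → value (f≡ x y) ≡ true ⇔ x ≡ y)
  where

  _⪯_ : Rel Carrier ℓ
  x ⪯ y = Lift ℓ (value x Bool.≤ value y)

  _≈_ : Rel Carrier ℓ
  x ≈ y = x ⪯ y × y ⪯ x

  ≈-intro : ∀ {x y} → value x ≡ value y → x ≈ y
  ≈-intro eq = lift (Bool.≤-reflexive eq) , lift (Bool.≤-reflexive (sym eq))

  ≈-elim : ∀ {x y} → x ≈ y → value x ≡ value y
  ≈-elim (lift x≤y , lift y≤x) = Bool.≤-antisym x≤y y≤x

  TRUE : Pred Carrier ℓ
  TRUE x = Lift ℓ (value x ≡ true)

  module B = IsBooleanAlgebra Bool.∨-∧-isBooleanAlgebra

  -- Since `_≈_` amounts to equality of values, `value` is a lattice monomorphism into `Bool`, and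
  -- the lattice laws pull back along it.
  isBooleanAlgebra : IsBooleanAlgebra _≈_ f∨ f∧ f¬ f⊤ f⊥
  isBooleanAlgebra = record
    { isDistributiveLattice = LatticeMonomorphism.isDistributiveLattice
        {L₁ = record { _≈_ = _≈_ ; _∧_ = f∧ ; _∨_ = f∨ }}
        {L₂ = record { _≈_ = _≡_ ; _∧_ = Bool._∧_ ; _∨_ = Bool._∨_ }}
        {⟦_⟧ = value}
        (record
          { isLatticeHomomorphism = record
            { isRelHomomorphism = record { cong = ≈-elim }
            ; ∧-homo            = value-∧
            ; ∨-homo            = value-∨
            }
          ; injective = ≈-intro
          })
        B.isDistributiveLattice
    ; ∨-complement =
        (λ x → ≈-intro (trans (value-∨ _ _)
          (trans (cong (Bool._∨ value x) (value-¬ x))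
            (trans (B.∨-complementˡ (value x)) (sym value-⊤)))))
      , (λ x → ≈-intro (trans (value-∨ _ _)
          (trans (cong (value x Bool.∨_) (value-¬ x))
            (trans (B.∨-complementʳ (value x)) (sym value-⊤)))))
    ; ∧-complement =
        (λ x → ≈-intro (trans (value-∧ _ _)
          (trans (cong (Bool._∧ value x) (value-¬ x))
            (trans (B.∧-complementˡ (value x)) (sym value-⊥)))))
      , (λ x → ≈-intro (trans (value-∧ _ _)
          (trans (cong (value x Bool.∧_) (value-¬ x))
            (trans (B.∧-complementʳ (value x)) (sym value-⊥)))))
    ; ¬-cong = λ {x} {y} x≈y → ≈-intro
        (trans (value-¬ x) (trans (cong Bool.not (≈-elim x≈y)) (sym (value-¬ y))))
    }

  ≤⇔∧ : ∀ b c → b Bool.≤ c ⇔ b Bool.∧ c ≡ b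
  ≤⇔∧ b c = mk⇔ to (from b c)
    where
    to : ∀ {b c} → b Bool.≤ c → b Bool.∧ c ≡ b
    to Bool.f≤t         = refl
    to (Bool.b≤b {b}) = Bool.∧-idem b
    from : ∀ b c → b Bool.∧ c ≡ b → b Bool.≤ c
    from true  true  _ = Bool.b≤b
    from false c     _ = Bool.≤-minimum c

  booleanPrealgebra : BooleanPrealgebra ℓ
  booleanPrealgebra = record
    { _⪯_ = _⪯_
    ; isPreorder = record
      { isEquivalence = Relation.Binary.PropositionalEquality.isEquivalence
      ; reflexive     = λ { refl → lift Bool.≤-refl }
      ; trans         = λ (lift x≤y) (lift y≤z) → lift (Bool.≤-trans x≤y y≤z)
      }
    ; quotientIsBooleanAlgebra = isBooleanAlgebra
    ; f→-cong = λ {x} {y} {u} {w} x≈y u≈w → ≈-intro (trans (value-→ x u)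
        (trans (cong₂ (λ b c → Bool.not b Bool.∨ c) (≈-elim x≈y) (≈-elim u≈w))
          (sym (value-→ y w))))
    ; f→-def = λ x y → ≈-intro (trans (value-→ x y)
        (trans (cong (Bool._∨ value y) (sym (value-¬ x))) (sym (value-∨ _ _))))
    ; ⪯⇔∧ = λ x y → mk⇔
        (λ (lift x≤y) →
          ≈-intro (trans (value-∧ x y) (Equivalence.to (≤⇔∧ _ _) x≤y)))
        (λ eq →
          lift (Equivalence.from (≤⇔∧ _ _) (trans (sym (value-∧ x y)) (≈-elim eq))))
    }

  open BooleanPrealgebra booleanPrealgebra using (quotient)

  isProperFilter : IsProperFilter quotient TRUE
  isProperFilter = record
    { respects = λ x≈y (lift x) → lift (trans (sym (≈-elim x≈y)) x)
    ; ⊤∈       = lift value-⊤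
    ; ∧-closed = λ (lift x) (lift y) → lift (trans (value-∧ _ _) (cong₂ Bool._∧_ x y))
    ; upward   = λ {x} {y} (lift x-true) eq → lift
        (trans (sym (trans (value-∧ x y) (cong (Bool._∧ value y) x-true)))
          (trans (≈-elim eq) x-true))
    ; ⊥∉       = λ (lift eq) → contradiction (trans (sym value-⊥) eq) λ ()
    }

  isUltrafilter : IsUltrafilter quotient TRUE
  isUltrafilter = record
    { isProperFilter = isProperFilter
    ; maximal        = maximal
    }
    where
    maximal : ∀ (G : Pred Carrier ℓ) → IsProperFilter quotient G → TRUE ⊆ G → G ⊆ TRUE
    maximal G G-proper TRUE⊆G {x} x∈G = lift (decide (value x) refl)
      where
      open IsProperFilter G-proper
      decide : ∀ b → value x ≡ b → value x ≡ true
      decide true  eq = eq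
      -- Here `f¬ x` lies in `TRUE`, hence in `G` together with `x`, and their meet is bottom.
      decide false eq = contradiction
        (respects (proj₂ (IsBooleanAlgebra.∧-complement isBooleanAlgebra) x)
          (∧-closed x∈G (TRUE⊆G (lift (trans (value-¬ x) (cong Bool.not eq))))))
        ⊥∉

  model : SCIModel ℓ
  model = record
    { booleanPrealgebra = booleanPrealgebra
    ; TRUE              = TRUE
    ; isUltrafilter     = isUltrafilter
    ; f≡                = f≡
    ; f≡-identity       = λ x y → mk⇔
        (λ (lift t) → Equivalence.to (value-≡ x y) t)
        (λ eq → lift (Equivalence.from (value-≡ x y) eq))
    }

  -- `Fm` is freely generated by the variables, so a homomorphism is determined by its values on
  -- them. It will be applied to the quotient map.
  ⟦⟧-unique : ∀ (κ : Fm → Carrier) → κ bot ≡ f⊥ → κ top ≡ f⊤ →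
              (∀ φ → κ (~ φ) ≡ f¬ (κ φ)) →
              (∀ φ ψ → κ (φ ⋁ ψ) ≡ f∨ (κ φ) (κ ψ)) →
              (∀ φ ψ → κ (φ ⋀ ψ) ≡ f∧ (κ φ) (κ ψ)) →
              (∀ φ ψ → κ (φ ⊃ ψ) ≡ f→ (κ φ) (κ ψ)) →
              (∀ φ ψ → κ (φ ≣ ψ) ≡ f≡ (κ φ) (κ ψ)) →
              ∀ φ → κ φ ≡ ⟦ model ⟧ φ (λ n → κ (var n))
  ⟦⟧-unique κ κ-⊥ κ-⊤ κ-¬ κ-∨ κ-∧ κ-→ κ-≡ = go
    where
    go : ∀ φ → κ φ ≡ ⟦ model ⟧ φ (λ n → κ (var n))
    go (var n) = refl
    go bot     = κ-⊥
    go top     = κ-⊤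
    go (~ φ)   = trans (κ-¬ φ) (cong f¬ (go φ))
    go (φ ⋁ ψ) = trans (κ-∨ φ ψ) (cong₂ f∨ (go φ) (go ψ))
    go (φ ⋀ ψ) = trans (κ-∧ φ ψ) (cong₂ f∧ (go φ) (go ψ))
    go (φ ⊃ ψ) = trans (κ-→ φ ψ) (cong₂ f→ (go φ) (go ψ))
    go (φ ≣ ψ) = trans (κ-≡ φ ψ) (cong₂ f≡ (go φ) (go ψ))

-- Complete theories

-- Kalmár's device: the literal asserts that `α` has truth value `b`, so a row of a truth table
-- becomes an entailment between literals.
literal : Bool → PFm → PFm
literal true  α = α
literal false α = pneg α

truth-literal : ∀ v b α → truth v (literal b α) ≡ true ⇔ truth v α ≡ b
truth-literal v true  α = mk⇔ id id
truth-literal v false α = mk⇔ Bool.not-injective (cong Bool.not)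

signed : Bool → Fm → Fm
signed true  φ = φ
signed false φ = ~ φ

literal-[] : ∀ b α σ → literal b α [ σ ] ≡ signed b (α [ σ ])
literal-[] true  α σ = refl
literal-[] false α σ = refl

module CompleteTheory (em : ExcludedMiddle ℓ) (T : Pred Fm ℓ)
                      (consistent : ¬ (T ⊢ bot))
                      (complete : ∀ φ → T ⊢ φ ⊎ T ⊢ ~ φ) where

  value : Fm → Bool
  value φ = does (em {T ⊢ φ})

  value-signed : ∀ φ → T ⊢ signed (value φ) φ
  value-signed φ with em {T ⊢ φ} | complete φ
  ... | yes d | _      = d
  ... | no ¬d | inj₁ d = contradiction d ¬d
  ... | no ¬d | inj₂ e = e

  -- Completeness of `T` provides a derivable signed formula; consistency fixes its sign. A value
  -- can therefore be computed by deriving either sign.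
  value-unique : ∀ b → T ⊢ signed b φ → value φ ≡ b
  value-unique true  d = dec-true em d
  value-unique false d = dec-false em λ e → consistent (⊢-contradiction e d)

  value-⊢ : value φ ≡ true → T ⊢ φ
  value-⊢ {φ} eq = subst (λ b → T ⊢ signed b φ) eq (value-signed φ)

  -- The derivable signed forms of `φ` and `ψ` entail that of the compound formula, by the
  -- corresponding row of its truth table.
  value-homo : ∀ α (_⊙_ : Op₂ Bool) → (∀ v → truth v α ≡ v 0 ⊙ v 1) →
               ∀ φ ψ → value (α [ ⟨ φ , ψ , bot ⟩ ]) ≡ value φ ⊙ value ψ
  value-homo α _⊙_ truth-α φ ψ = value-unique (value φ ⊙ value ψ)
    (subst (T ⊢_) (literal-[] (value φ ⊙ value ψ) α σ)
      (consequence₂ (literal (value φ) p) (literal (value ψ) q)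
                    (literal (value φ ⊙ value ψ) α)
        (λ v s t → Equivalence.from (truth-literal v _ α)
          (trans (truth-α v)
            (cong₂ _⊙_ (Equivalence.to (truth-literal v _ p) s)
                       (Equivalence.to (truth-literal v _ q) t))))
        σ
        (subst (T ⊢_) (sym (literal-[] (value φ) p σ)) (value-signed φ))
        (subst (T ⊢_) (sym (literal-[] (value ψ) q σ)) (value-signed ψ))))
    where
    σ : ℕ → Fm
    σ = ⟨ φ , ψ , bot ⟩

  -- The derivable signed form of `φ` is carried over to `ψ`: directly if positive, through `cong-~`
  -- if negative.
  value-≣ : T ⊢ φ ≣ ψ → value φ ≡ value ψ
  value-≣ {φ} {ψ} d = sym (value-unique (value φ) (transport (value φ) (value-signed φ)))
    where
    transport : ∀ b → T ⊢ signed b φ → T ⊢ signed b ψ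
    transport true  = ⊢-≣-elim d
    transport false = ⊢-≣-elim (mp d (axiom (cong-~ _ _)))

  open Quotient em formula formula-surjective (⊢-≣-isEquivalence {Φ = T})

  value-repr : ∀ φ → value (repr (classOf φ)) ≡ value φ
  value-repr φ = value-≣ (repr-classOf φ)

  op₁ : (Fm → Fm) → Op₁ Class
  op₁ f c = classOf (f (repr c))

  op₂ : (Fm → Fm → Fm) → Op₂ Class
  op₂ f c d = classOf (f (repr c) (repr d))

  value-op₂ : ∀ α (_⊙_ : Op₂ Bool) → (∀ v → truth v α ≡ v 0 ⊙ v 1) → ∀ c d →
              value (repr (op₂ (λ φ ψ → α [ ⟨ φ , ψ , bot ⟩ ]) c d)) ≡
              value (repr c) ⊙ value (repr d)
  value-op₂ α _⊙_ truth-α c d =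
    trans (value-repr _) (value-homo α _⊙_ truth-α (repr c) (repr d))

  -- An identity has value `true` just when `T` derives it, and formulas identified by `T` share one
  -- representative.
  value-op₂-≣ : ∀ c d → value (repr (op₂ _≣_ c d)) ≡ true ⇔ c ≡ d
  value-op₂-≣ c d = mk⇔
    (λ eq → repr-injective (value-⊢ (trans (sym (value-repr _)) eq)))
    (λ { refl → trans (value-repr _) (value-unique true (axiom (≣-refl _))) })

  open TwoValued (op₂ _⋁_) (op₂ _⋀_) (op₂ _⊃_) (op₂ _≣_) (op₁ ~_)
                 (classOf bot) (classOf top) (value ∘ repr)
    (value-op₂ (por p q) Bool._∨_ λ _ → refl)
    (value-op₂ (pand p q) Bool._∧_ λ _ → refl)
    (value-op₂ (pimp p q) (λ b c → Bool.not b Bool.∨ c) λ _ → refl)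
    -- Negation and the constants are treated as binary connectives; the second `c` and the two
    -- `bot`s below are fillers.
    (λ c → value-op₂ (pneg p) (λ b _ → Bool.not b) (λ _ → refl) c c)
    (trans (value-repr bot) (value-homo pbot (λ _ _ → false) (λ _ → refl) bot bot))
    (trans (value-repr top) (value-homo ptop (λ _ _ → true) (λ _ → refl) bot bot))
    value-op₂-≣
    public using (model; ⟦⟧-unique)

  assignment : ℕ → Class
  assignment n = classOf (var n)

  -- The operations act on chosen representatives, which `T` only proves identical to the given
  -- formulas; the congruence axioms bridge the gap, here and for the binary connectives.
  classOf-op₁ : ∀ φ → classOf (~ φ) ≡ op₁ ~_ (classOf φ)
  classOf-op₁ φ = sym (classOf-cong (mp (repr-classOf φ) (axiom (cong-~ _ _))))

  classOf-op₂ : ∀ (_⊛_ : Fm → Fm → Fm) →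
                (∀ φ₁ ψ₁ φ₂ ψ₂ → Axiom (((φ₁ ≣ ψ₁) ⋀ (φ₂ ≣ ψ₂)) ⊃ ((φ₁ ⊛ φ₂) ≣ (ψ₁ ⊛ ψ₂)))) →
                ∀ φ ψ → classOf (φ ⊛ ψ) ≡ op₂ _⊛_ (classOf φ) (classOf ψ)
  classOf-op₂ _⊛_ cong-⊛ φ ψ = sym (classOf-cong
    (mp (⊢-⋀-intro (repr-classOf φ) (repr-classOf ψ)) (axiom (cong-⊛ _ _ _ _))))

  classOf-⟦⟧ : ∀ φ → classOf φ ≡ ⟦ model ⟧ φ assignment
  classOf-⟦⟧ = ⟦⟧-unique classOf refl refl classOf-op₁ (classOf-op₂ _⋁_ cong-⋁)
    (classOf-op₂ _⋀_ cong-⋀) (classOf-op₂ _⊃_ cong-⊃) (classOf-op₂ _≣_ cong-≣)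

  value-⟦⟧ : ∀ φ → value (repr (⟦ model ⟧ φ assignment)) ≡ value φ
  value-⟦⟧ φ = trans (cong (value ∘ repr) (sym (classOf-⟦⟧ φ))) (value-repr φ)

  -- The truth lemma: a formula denotes its own class, and passing to the representative preserves
  -- its value.
  satisfies⇔⊢ : ∀ φ → Satisfies model assignment φ ⇔ (T ⊢ φ)
  satisfies⇔⊢ φ = mk⇔
    (λ (lift eq) → value-⊢ (trans (sym (value-⟦⟧ φ)) eq))
    (λ d → lift (trans (value-⟦⟧ φ) (value-unique true d)))

-- Lindenbaum's lemma

module Lindenbaum (em : ExcludedMiddle ℓ) (Φ : Pred Fm ℓ) (φ : Fm) (Φ⊬φ : ¬ (Φ ⊢ φ)) where

  -- The condition for adding the `n`-th formula is part of the predicate, so no case distinction is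
  -- needed to define a stage.
  stage : ℕ → Pred Fm ℓ
  stage zero      = Φ
  stage (suc n) ψ = stage n ψ ⊎ (formula n ≡ ψ × ¬ (stage n ∪ ｛ ψ ｝ ⊢ φ))

  -- A derivation of `φ` from the next stage is also one from `stage n` with `formula n` adjoined.
  -- That refutes the condition for adding `formula n`, so the derivation already lives in
  -- `stage n`.
  stage-⊬ : ∀ n → ¬ (stage n ⊢ φ)
  stage-⊬ zero    d = Φ⊬φ d
  stage-⊬ (suc n) d = stage-⊬ n (⊢-mono [ id , nothing-added ] d)
    where
    e : stage n ∪ ｛ formula n ｝ ⊢ φ
    e = ⊢-mono (map₂ proj₁) d
    nothing-added : formula n ≡ ψ × ¬ (stage n ∪ ｛ ψ ｝ ⊢ φ) → ψ ∈ stage n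
    nothing-added (refl , ¬e) = contradiction e ¬e

  stage-mono : ∀ {m n} → m ≤′ n → stage m ⊆ stage n
  stage-mono ≤′-refl       = id
  stage-mono (≤′-step m≤n) = inj₁ ∘ stage-mono m≤n

  limit : Pred Fm ℓ
  limit ψ = ∃ λ n → ψ ∈ stage n

  -- Derivations are finite and the stages increase; the two premises of `mp` meet at the larger of
  -- their stages.
  limit-compact : limit ⊢ ψ → ∃ λ n → stage n ⊢ ψ
  limit-compact (hyp (n , ψ∈)) = n , hyp ψ∈
  limit-compact (axiom ax)     = zero , axiom ax
  limit-compact (mp d e) =
    let m , d′ = limit-compact d
        n , e′ = limit-compact e
    in m ⊔ n , mp (⊢-mono (stage-mono (≤⇒≤′ (m≤m⊔n m n))) d′)
                  (⊢-mono (stage-mono (≤⇒≤′ (m≤n⊔m m n))) e′)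

  limit-⊬ : ¬ (limit ⊢ φ)
  limit-⊬ d = uncurry stage-⊬ (limit-compact d)

  -- At a stage where `ψ` is considered, it is either added or found to yield `φ`; in the latter
  -- case the deduction theorem applies.
  limit-⊢ : ∀ ψ → limit ⊢ ψ ⊎ limit ⊢ ψ ⊃ φ
  limit-⊢ ψ with formula-surjective ψ
  ... | n , eq with em {stage n ∪ ｛ ψ ｝ ⊢ φ}
  ...   | yes d = inj₂ (⊢-mono (n ,_) (deduction d))
  ...   | no ¬d = inj₁ (hyp (suc n , inj₂ (eq , ¬d)))

  limit-consistent : ¬ (limit ⊢ bot)
  limit-consistent d = limit-⊬ (⊢-explosion d)

  limit-complete : ∀ ψ → limit ⊢ ψ ⊎ limit ⊢ ~ ψ
  limit-complete ψ with limit-⊢ ψ | limit-⊢ (~ ψ)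
  ... | inj₁ d | _      = inj₁ d
  ... | inj₂ d | inj₁ e = inj₂ e
  -- If both `ψ` and its negation imply `φ`, then `φ` is derivable by cases.
  ... | inj₂ d | inj₂ e = contradiction (⊢-cases d e) limit-⊬

completeness : ExcludedMiddle ℓ → ∀ (Φ : Pred Fm ℓ) φ → Φ ⊩ φ → Φ ⊢ φ
completeness em Φ φ Φ⊩φ with em {Φ ⊢ φ}
... | yes Φ⊢φ = Φ⊢φ
... | no  Φ⊬φ = contradiction
  (Equivalence.to (satisfies⇔⊢ φ)
    (Φ⊩φ model assignment λ ψ ψ∈Φ →
      -- The witness `zero` is the stage that equals `Φ`.
      Equivalence.from (satisfies⇔⊢ ψ) (hyp (zero , ψ∈Φ))))
  limit-⊬
  where
  open Lindenbaum em Φ φ Φ⊬φ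
  open CompleteTheory em limit limit-consistent limit-complete

-- Soundness

reflects-⇔ : ∀ {A B : Set a} {b} → A ⇔ B → Reflects A b → Reflects B b
reflects-⇔ A⇔B (ofʸ x)  = ofʸ (Equivalence.to A⇔B x)
reflects-⇔ A⇔B (ofⁿ ¬x) = ofⁿ (¬x ∘ Equivalence.from A⇔B)

module Ultrafilter {ℓ} (em : ExcludedMiddle ℓ) (M : SCIModel ℓ) where

  open SCIModel M
  open IsUltrafilter isUltrafilter
  open IsProperFilter isProperFilter
  open BooleanAlgebra quotient using (∧-comm; ∨-comm; ∧-congˡ; ∨-congˡ; ∨-distribˡ-∧;
    ∧-absorbs-∨; ∨-complementˡ; ∧-complementʳ; ∧-assoc)
    renaming (sym to ≈-sym; trans to ≈-trans)
  open BooleanAlgebraProperties quotient using (∧-idem; ∨-zeroʳ; ∨-identityʳ; deMorgan₂)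

  ∨-introˡ : ∀ {a b} → a ∈ TRUE → f∨ a b ∈ TRUE
  ∨-introˡ a∈ = upward a∈ (∧-absorbs-∨ _ _)

  ∨-introʳ : ∀ {a b} → b ∈ TRUE → f∨ a b ∈ TRUE
  ∨-introʳ b∈ = respects (∨-comm _ _) (∨-introˡ b∈)

  ∧-elimʳ : ∀ {a b} → f∧ a b ∈ TRUE → b ∈ TRUE
  ∧-elimʳ {a} {b} ab∈ = upward ab∈
    (≈-trans (∧-assoc a b b) (∧-congˡ (∧-idem b)))

  ∧-elimˡ : ∀ {a b} → f∧ a b ∈ TRUE → a ∈ TRUE
  ∧-elimˡ ab∈ = ∧-elimʳ (respects (∧-comm _ _) ab∈)

  ¬-disjoint : ∀ {a} → a ∈ TRUE → f¬ a ∉ TRUE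
  ¬-disjoint {a} a∈ ¬a∈ = ⊥∉ (respects (∧-complementʳ a) (∧-closed a∈ ¬a∈))

  -- The filter generated by TRUE and a.
  adjoin : Carrier → Pred Carrier ℓ
  adjoin a b = f∨ (f¬ a) b ∈ TRUE

  -- Closure under meets and upward closure follow from distributivity. Properness holds because
  -- bottom could enter only if `f∨ (f¬ a) f⊥`, which is `f¬ a`, were in `TRUE`.
  adjoin-isProperFilter : ∀ {a} → f¬ a ∉ TRUE → IsProperFilter quotient (adjoin a)
  adjoin-isProperFilter {a} ¬a∉ = record
    { respects = λ b≈c → respects (∨-congˡ b≈c)
    ; ⊤∈       = respects (≈-sym (∨-zeroʳ _)) ⊤∈
    ; ∧-closed = λ b∈ c∈ → respects (≈-sym (∨-distribˡ-∧ _ _ _)) (∧-closed b∈ c∈)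
    ; upward   = λ b∈ bc≈b →
        upward b∈ (≈-trans (≈-sym (∨-distribˡ-∧ _ _ _)) (∨-congˡ bc≈b))
    ; ⊥∉       = λ ¬a∈ → ¬a∉ (respects (∨-identityʳ _) ¬a∈)
    }

  -- If `f¬ a` were also missing, `adjoin a` would be a proper filter extending `TRUE` and
  -- containing `a`, against maximality.
  decides : ∀ a → a ∉ TRUE → f¬ a ∈ TRUE
  decides a a∉ with em {f¬ a ∈ TRUE}
  ... | yes ¬a∈ = ¬a∈
  ... | no  ¬a∉ = contradiction
    (maximal (adjoin a) (adjoin-isProperFilter ¬a∉) ∨-introʳ
      (respects (≈-sym (∨-complementˡ a)) ⊤∈))
    a∉

  ¬-TRUE : ∀ {a} → a ∉ TRUE ⇔ f¬ a ∈ TRUE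
  ¬-TRUE = mk⇔ (decides _) (λ ¬a∈ a∈ → ¬-disjoint a∈ ¬a∈)

  ∧-TRUE : ∀ {a b} → (a ∈ TRUE × b ∈ TRUE) ⇔ f∧ a b ∈ TRUE
  ∧-TRUE = mk⇔ (uncurry ∧-closed) (λ ab∈ → ∧-elimˡ ab∈ , ∧-elimʳ ab∈)

  ∨-TRUE : ∀ {a b} → (a ∈ TRUE ⊎ b ∈ TRUE) ⇔ f∨ a b ∈ TRUE
  ∨-TRUE {a} {b} = mk⇔ [ ∨-introˡ , ∨-introʳ ] split
    where
    split : f∨ a b ∈ TRUE → a ∈ TRUE ⊎ b ∈ TRUE
    split ab∈ with em {a ∈ TRUE} | em {b ∈ TRUE}
    ... | yes a∈ | _      = inj₁ a∈
    ... | no _   | yes b∈ = inj₂ b∈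
    ... | no a∉  | no b∉  = contradiction
      (respects (≈-sym (deMorgan₂ a b)) (∧-closed (decides a a∉) (decides b b∉)))
      (¬-disjoint ab∈)

  -- The disjunctive form matches the clause of `truth` for implication.
  →-TRUE : ∀ {a b} → (a ∉ TRUE ⊎ b ∈ TRUE) ⇔ f→ a b ∈ TRUE
  →-TRUE {a} {b} = mk⇔
    (λ s → respects (≈-sym (f→-def a b))
      ([ ∨-introˡ ∘ decides a , ∨-introʳ ] s))
    (λ ab∈ → [ inj₁ ∘ Equivalence.from ¬-TRUE , inj₂ ]
      (Equivalence.from ∨-TRUE (respects (f→-def a b) ab∈)))

  →-intro : ∀ {a b} → (a ∈ TRUE → b ∈ TRUE) → f→ a b ∈ TRUE
  →-intro {a} f with em {a ∈ TRUE}
  ... | yes a∈ = Equivalence.to →-TRUE (inj₂ (f a∈))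
  ... | no  a∉ = Equivalence.to →-TRUE (inj₁ a∉)

  →-elim : ∀ {a b} → a ∈ TRUE → f→ a b ∈ TRUE → b ∈ TRUE
  →-elim a∈ ab∈ = [ contradiction a∈ , id ] (Equivalence.from →-TRUE ab∈)

  ≡-elim : ∀ {a b} → f≡ a b ∈ TRUE → a ≡ b
  ≡-elim = Equivalence.to (f≡-identity _ _)

  ≡-intro : ∀ {a b} → a ≡ b → f≡ a b ∈ TRUE
  ≡-intro = Equivalence.from (f≡-identity _ _)

  module _ (γ : ℕ → Carrier) where

    -- The valuation gives each variable the truth value of its substitute in the model; the
    -- equivalences above then follow the clauses of `truth`.
    satisfies-reflects : ∀ α σ →
      Reflects (Satisfies M γ (α [ σ ])) (truth (λ n → does (em {Satisfies M γ (σ n)})) α)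
    satisfies-reflects (pvar n)   σ = proof em
    satisfies-reflects pbot       σ = ofⁿ ⊥∉
    satisfies-reflects ptop       σ = ofʸ ⊤∈
    satisfies-reflects (pneg α)   σ =
      reflects-⇔ ¬-TRUE (¬-reflects (satisfies-reflects α σ))
    satisfies-reflects (por α β)  σ =
      reflects-⇔ ∨-TRUE (satisfies-reflects α σ ⊎-reflects satisfies-reflects β σ)
    satisfies-reflects (pand α β) σ =
      reflects-⇔ ∧-TRUE (satisfies-reflects α σ ×-reflects satisfies-reflects β σ)
    satisfies-reflects (pimp α β) σ =
      reflects-⇔ →-TRUE (¬-reflects (satisfies-reflects α σ) ⊎-reflects satisfies-reflects β σ)

    satisfies-taut : ∀ α → Tautology α → ∀ σ → Satisfies M γ (α [ σ ])
    satisfies-taut α α-taut σ with satisfies-reflects α σ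
    ... | r rewrite α-taut (λ n → does (em {Satisfies M γ (σ n)})) with r
    ...   | ofʸ s = s

    -- A true identity is an actual equality of elements, which every operation respects.
    cong₂-TRUE : ∀ (f : Op₂ Carrier) {a b c d} →
                 f→ (f∧ (f≡ a b) (f≡ c d)) (f≡ (f a c) (f b d)) ∈ TRUE
    cong₂-TRUE f = →-intro λ h →
      ≡-intro (cong₂ f (≡-elim (∧-elimˡ h)) (≡-elim (∧-elimʳ h)))

    satisfies-axiom : Axiom φ → Satisfies M γ φ
    satisfies-axiom (taut α α-taut σ) = satisfies-taut α α-taut σ
    satisfies-axiom (≣-refl φ)        = ≡-intro refl
    satisfies-axiom (≣-⊃ φ ψ)         =
      →-intro λ h → →-intro λ φ∈ → subst TRUE (≡-elim h) φ∈
    satisfies-axiom (cong-~ φ ψ)      = →-intro λ h → ≡-intro (cong f¬ (≡-elim h))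
    satisfies-axiom (cong-⋁ _ _ _ _)  = cong₂-TRUE f∨
    satisfies-axiom (cong-⋀ _ _ _ _)  = cong₂-TRUE f∧
    satisfies-axiom (cong-⊃ _ _ _ _)  = cong₂-TRUE f→
    satisfies-axiom (cong-≣ _ _ _ _)  = cong₂-TRUE f≡

soundness : ExcludedMiddle ℓ → ∀ (Φ : Pred Fm ℓ) φ → Φ ⊢ φ → Φ ⊩ φ
soundness em Φ φ d M γ M⊨Φ = satisfied d
  where
  open Ultrafilter em M
  satisfied : Φ ⊢ ψ → Satisfies M γ ψ
  satisfied (hyp ψ∈Φ)  = M⊨Φ _ ψ∈Φ
  satisfied (axiom ax) = satisfies-axiom γ ax
  satisfied (mp d e)   = →-elim (satisfied d) (satisfied e)

theorem3p10 : ∀ {ℓ} → ExcludedMiddle ℓ →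
    ∀ (Φ : Pred Fm ℓ) (φ : Fm) → (Φ ⊩ φ) ⇔ (Φ ⊢ φ)
theorem3p10 em Φ φ = mk⇔ (completeness em Φ φ) (soundness em Φ φ)
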